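{- Let $m\ge 2$ be an integer and let $n$ be a positive integer with $m^j\le n<m^{j+1}$ for some integer $j\ge 0$, with base $m$ representation $n=\alpha_j m^j+\cdots+\alpha_1 m+\alpha_0$ ($\alpha_j>0$, $0\le\alpha_i\le m-1$). For $i\ge 1$ let $\chi_i=0$ if $\alpha_{i-1}>0$ and $\chi_i=1$ if $\alpha_{i-1}=0$. Then the number $c_m(n)$ of $m$-ary partitions of $n$ without gaps satisfies \[ c_m(n)=1+\sum_{r=1}^{j}\ \sum_{k_r=\chi_r}^{\lfloor n/m^r\rfloor-1}\ \sum_{k_{r-1}=\chi_{r-1}}^{\alpha_{r-1}-1+mk_r}\cdots\sum_{k_1=\chi_1}^{\alpha_1-1+mk_2}1, \] that is, $c_m(n)=1+\sum_{r=1}^j N_r$, where $N_r$ is the number of integer tuples $(k_r,\ldots,k_1)$ with $\chi_r\le k_r\le \lfloor n/m^r\rfloor-1$ and $\chi_i\le k_i\le \alpha_i-1+mk_{i+1}$ for $1\le i\le r-1$.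
   Context: An $m$-ary partition of a positive integer $n$ is a partition of $n$ in which every part is a power of $m$. It is without gaps if, whenever $m^i$ is its largest part, every $m^k$ with $0\le k<i$ also appears as a part. $c_m(n)$ denotes the number of $m$-ary partitions of $n$ without gaps. $\lfloor a\rfloor$ is the floor of $a$. -}

module Defs where

open import Data.Bool using (if_then_else_)
open import Data.Fin using (Fin)
open import Data.Integer as ℤ using (ℤ; +_; 0ℤ; 1ℤ)
open import Data.List using (List; applyUpTo; map)
open import Data.List.Membership.Propositional using (_∈_)
open import Data.List.Relation.Unary.All using (All)
open import Data.List.Relation.Unary.Linked using (Linked)
open import Data.Nat
open import Data.Nat.DivMod using (_/_)
open import Data.Nat.ListAction using (sum)
open import Data.Nat.Properties using (m^n≢0)
open import Data.Product using (Σ; ∃-syntax; _×_; proj₁)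
open import Data.Unit using (⊤)
open import Data.Vec using (Vec; []; _∷_)
open import Function.Bundles using (Bijection)
import Relation.Binary.Construct.On as On
open import Relation.Binary.PropositionalEquality using (_≡_; setoid)

-- "There are exactly c elements of A satisfying P".  Elements are compared by
-- their first components only, so distinct proofs of P x are not counted apart.
HasCardinality : {A : Set} → (A → Set) → ℕ → Set
HasCardinality {A} P c =
  Bijection (setoid (Fin c)) (On.setoid (setoid A) (proj₁ {A = A} {B = P}))

-- A partition is the list of its parts in weakly decreasing order.
record IsPartition (n : ℕ) (parts : List ℕ) : Set where
  field
    decreasing : Linked _≥_ parts
    positive   : All (0 <_) parts
    total      : sum parts ≡ n

IsPowerOf : ℕ → ℕ → Set
IsPowerOf m p = ∃[ i ] p ≡ m ^ i

IsLargestPart : ℕ → List ℕ → Set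
IsLargestPart p parts = p ∈ parts × All (_≤ p) parts

WithoutGaps : ℕ → List ℕ → Set
WithoutGaps m parts =
  ∀ i → IsLargestPart (m ^ i) parts → ∀ k → k < i → (m ^ k) ∈ parts

record IsGaplessMAryPartition (m n : ℕ) (parts : List ℕ) : Set where
  field
    isPartition : IsPartition n parts
    mAry        : All (IsPowerOf m) parts
    withoutGaps : WithoutGaps m parts

-- α i is the coefficient of m ^ i; values α i with i > j are unconstrained.
record IsBaseRepresentation (m n j : ℕ) (α : ℕ → ℕ) : Set where
  field
    leading : α j > 0
    digit   : ∀ i → i ≤ j → α i ≤ m ∸ 1
    value   : n ≡ sum (applyUpTo (λ i → α i * m ^ i) (suc j))

-- The integers k with lo ≤ k ≤ hi in increasing order; empty when hi < lo.
interval : ℤ → ℤ → List ℤ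
interval lo hi = applyUpTo (λ t → lo ℤ.+ + t) ℤ.∣ (hi ℤ.- lo ℤ.+ 1ℤ) ℤ.⊔ 0ℤ ∣

sumBetween : ℤ → ℤ → (ℤ → ℕ) → ℕ
sumBetween lo hi f = sum (map f (interval lo hi))

-- Only used for i ≥ 1.
χ : (ℕ → ℕ) → ℕ → ℤ
χ α i = if α (pred i) ≡ᵇ 0 then 1ℤ else 0ℤ

-- The upper limit α_i - 1 + m k_{i+1} of k_i, as a function of k = k_{i+1}.
upper : ℕ → (ℕ → ℕ) → ℕ → ℤ → ℤ
upper m α i k = + α i ℤ.- 1ℤ ℤ.+ + m ℤ.* k

topUpper : (m n r : ℕ) .{{_ : NonZero m}} → ℤ
topUpper m n r = + ((n / (m ^ r)) {{m^n≢0 m r}}) ℤ.- 1ℤ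

-- The r-fold sum over k_r , … , k_1 of 1, where hi is the upper limit of k_r.
-- At the last step (i = 0) the limit passed on is discarded.
nestedSum : ℕ → (ℕ → ℕ) → (r : ℕ) → (hi : ℤ) → ℕ
nestedSum m α zero    hi = 1
nestedSum m α (suc i) hi =
  sumBetween (χ α (suc i)) hi (λ k → nestedSum m α i (upper m α i k))

N : (m n : ℕ) .{{_ : NonZero m}} → (ℕ → ℕ) → ℕ → ℕ
N m n α r = nestedSum m α r (topUpper m n r)

-- The constraints on a tuple (k_r , … , k_1), listed in this order, where hi
-- is the upper limit of k_r; the entry heading a vector of length i + 1 is
-- k_{i+1}.
WithinLimits : ℕ → (ℕ → ℕ) → {r : ℕ} → (hi : ℤ) → Vec ℤ r → Set
WithinLimits m α hi []                = ⊤
WithinLimits m α hi (_∷_ {n = i} k ks) =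
  χ α (suc i) ℤ.≤ k × k ℤ.≤ hi × WithinLimits m α (upper m α i k) ks

IsAdmissible : (m n : ℕ) .{{_ : NonZero m}} → (ℕ → ℕ) → (r : ℕ) → Vec ℤ r → Set
IsAdmissible m n α r ks = WithinLimits m α (topUpper m n r) ks

{-# OPTIONS --safe #-}
module Submission where

-- A gapless partition with largest part mʳ is a choice of multiplicities
-- a_0 , … , a_r ≥ 1 with Σ a_i mⁱ = n.  Let (⌊n/mⁱ⌋ - k_i) mⁱ be the sum of its
-- parts that are at least mⁱ, so that k_0 = 0.  Then a_r = ⌊n/mʳ⌋ - k_r and
-- a_i = α_i + m k_{i+1} - k_i for i < r, and a_i ≥ 1 for i ≥ 1 is the upper limit
-- of k_i.  The lower limit χ_i says that the upper limit of k_{i-1} is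
-- nonnegative.  It holds because the parts below mⁱ include mⁱ⁻¹, so that
-- their sum exceeds n mod mⁱ⁻¹.  For i = 1 it is the condition a_0 ≥ 1.
-- The summand 1 counts the partition with r = 0 and is N 0 by convention.

open import Data.Bool using (if_then_else_)
open import Data.Fin using (zero; suc)
open import Data.Integer as ℤ using (ℤ; +_; 0ℤ; 1ℤ)
import Data.Integer.Properties as ℤ
open import Data.Integer.Tactic.RingSolver using (solve-∀)
open import Data.List using (List; []; _∷_; _++_; applyUpTo; length; lookup; map; replicate; upTo)
open import Data.List.Membership.Propositional using (_∈_)
open import Data.List.Membership.Propositional.Properties
open import Data.List.Properties using (∷-injectiveʳ; ++-cancelˡ; length-++; length-map; map-upTo; applyUpTo-∷ʳ)
open import Data.List.Relation.Unary.All as All using (All; []; _∷_)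
import Data.List.Relation.Unary.All.Properties as All
open import Data.List.Relation.Unary.AllPairs using (AllPairs; []; _∷_)
open import Data.List.Relation.Unary.Any using (here; there; index)
import Data.List.Relation.Unary.Any.Properties as Any
open import Data.List.Relation.Unary.Linked.Properties using (AllPairs⇒Linked; Linked⇒AllPairs)
open import Data.List.Relation.Unary.Unique.Propositional using (Unique)
import Data.List.Relation.Unary.Unique.Propositional.Properties as Unique
open import Data.Nat
open import Data.Nat.DivMod
open import Data.Nat.ListAction using (sum)
open import Data.Nat.ListAction.Properties using (sum-++)
open import Data.Nat.Properties
open import Data.Product using (∃-syntax; _×_; _,_; proj₁; proj₂)
open import Data.Sum using (_⊎_; inj₁; inj₂; [_,_])
open import Data.Unit using (tt)
open import Data.Vec using ([]; _∷_)
open import Data.Vec.Properties using (∷-injective)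
open import Function using (_∘_)
open import Relation.Binary.PropositionalEquality hiding ([_])
open import Relation.Nullary using (¬_; contradiction; yes; no)
open import Defs

import Algebra.Properties.AbelianGroup ℤ.+-0-abelianGroup as ℤ-Group

-- Counting by duplicate-free lists.

-- An explicit list of the elements can be concatenated and mapped, so sizes of disjoint unions and
-- images are immediate. The passage to `HasCardinality` happens only once, at the end.
record Counted {A : Set} (P : A → Set) (c : ℕ) : Set where
  field
    elements : List A
    unique   : Unique elements
    sound    : ∀ {x} → x ∈ elements → P x
    complete : ∀ {x} → P x → x ∈ elements
    size     : length elements ≡ c

lookup-injective : ∀ {A : Set} {xs : List A} → Unique xs →
  ∀ i j → lookup xs i ≡ lookup xs j → i ≡ j
lookup-injective (_ ∷ _)   zero    zero    eq = refl
lookup-injective (x∉ ∷ u)  zero    (suc j) eq =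
  contradiction eq (All.lookup x∉ (∈-lookup j))
lookup-injective (x∉ ∷ u)  (suc i) zero    eq =
  contradiction (sym eq) (All.lookup x∉ (∈-lookup i))
lookup-injective (_ ∷ u)   (suc i) (suc j) eq = cong suc (lookup-injective u i j eq)

counted⇒cardinality : ∀ {A : Set} {P : A → Set} {c} → Counted P c → HasCardinality P c
counted⇒cardinality record
  { elements = xs ; unique = u ; sound = s ; complete = cpl ; size = refl } = record
  { to        = λ i → lookup xs i , s (∈-lookup i)
  ; cong      = cong (lookup xs)
  ; bijective = (λ {i} {j} → lookup-injective u i j)
              , λ { (y , py) → index (cpl py)
                  , λ { refl → sym (Any.lookup-index (cpl py)) } }
  }

module _ {A : Set} where

  counted-resp : ∀ {P Q : A → Set} {c} → (∀ {x} → P x → Q x) → (∀ {x} → Q x → P x) →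
    Counted P c → Counted Q c
  counted-resp f g C = record
    { elements = elements ; unique = unique ; sound = f ∘ sound
    ; complete = complete ∘ g ; size = size }
    where open Counted C

  counted-∅ : ∀ {P : A → Set} → (∀ {x} → ¬ P x) → Counted P 0
  counted-∅ ¬p = record
    { elements = [] ; unique = [] ; sound = λ ()
    ; complete = λ p → contradiction p ¬p ; size = refl }

  counted-singleton : (a : A) → Counted (_≡ a) 1
  counted-singleton a = record
    { elements = a ∷ [] ; unique = [] ∷ [] ; sound = λ { (here eq) → eq }
    ; complete = here ; size = refl }

  counted-⊎ : ∀ {P Q : A → Set} {c d} → (∀ {x} → P x → ¬ Q x) →
    Counted P c → Counted Q d → Counted (λ x → P x ⊎ Q x) (c + d)
  counted-⊎ disjoint C D = record
    { elements = C.elements ++ D.elements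
    ; unique   = Unique.++⁺ C.unique D.unique
                   λ (x∈C , x∈D) → disjoint (C.sound x∈C) (D.sound x∈D)
    ; sound    = λ x∈ → [ inj₁ ∘ C.sound , inj₂ ∘ D.sound ] (∈-++⁻ C.elements x∈)
    ; complete = [ ∈-++⁺ˡ ∘ C.complete , ∈-++⁺ʳ C.elements ∘ D.complete ]
    ; size     = trans (length-++ C.elements) (cong₂ _+_ C.size D.size)
    }
    where module C = Counted C
          module D = Counted D

  -- The second hypothesis makes the fibres `P k` disjoint, so their sizes add up. It is restricted
  -- to indices in `ks` so that the bounds carried by membership in an interval can be used to prove
  -- it.
  counted-∃ : ∀ {K : Set} {P : K → A → Set} {c : K → ℕ} {ks} → Unique ks →
    (∀ {k l x} → k ∈ ks → l ∈ ks → P k x → P l x → k ≡ l) →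
    (∀ {k} → k ∈ ks → Counted (P k) (c k)) →
    Counted (λ x → ∃[ k ] k ∈ ks × P k x) (sum (map c ks))
  counted-∃ []       inj C = counted-∅ λ ()
  counted-∃ (k∉ ∷ u) inj C = counted-resp
    [ (λ p → _ , here refl , p) , (λ (k , k∈ , p) → k , there k∈ , p) ]
    (λ { (_ , here refl , p) → inj₁ p ; (k , there k∈ , p) → inj₂ (k , k∈ , p) })
    (counted-⊎ (λ { p (l , l∈ , q) → All.lookup k∉ l∈ (inj (here refl) (there l∈) p q) })
      (C (here refl)) (counted-∃ u (λ k∈ l∈ → inj (there k∈) (there l∈)) (C ∘ there)))

counted-image : ∀ {A B : Set} {P : A → Set} {c} {f : A → B} →
  (∀ {x y} → f x ≡ f y → x ≡ y) →
  Counted P c → Counted (λ y → ∃[ x ] P x × y ≡ f x) c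
counted-image {f = f} inj C = record
  { elements = map f elements
  ; unique   = Unique.map⁺ inj unique
  ; sound    = λ y∈ → let (x , x∈ , eq) = ∈-map⁻ f y∈ in x , sound x∈ , eq
  ; complete = λ { (x , p , refl) → ∈-map⁺ f (complete p) }
  ; size     = trans (length-map f elements) size
  }
  where open Counted C

-- Integer intervals and tuples within limits.

-- This and its converse deal with the truncated length of `interval`: for negative `d` the length
-- is 0 and both inequalities are impossible.
<-∣⊔0∣⁻ : ∀ {t} d → t < ℤ.∣ d ℤ.⊔ 0ℤ ∣ → + suc t ℤ.≤ d
<-∣⊔0∣⁻ (+ d) t<d rewrite ⊔-identityʳ d = ℤ.+≤+ t<d

<-∣⊔0∣⁺ : ∀ {t} d → + suc t ℤ.≤ d → t < ℤ.∣ d ℤ.⊔ 0ℤ ∣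
<-∣⊔0∣⁺ (+ d) (ℤ.+≤+ t<d) rewrite ⊔-identityʳ d = t<d

interval-unique : ∀ lo hi → Unique (interval lo hi)
interval-unique lo hi = Unique.applyUpTo⁺₁ _ _ λ i<j _ eq →
  <⇒≢ i<j (ℤ.+-injective (ℤ-Group.∙-cancelˡ lo _ _ eq))

∈-interval⁻ : ∀ {lo hi k} → k ∈ interval lo hi → lo ℤ.≤ k × k ℤ.≤ hi
∈-interval⁻ {lo} {hi} k∈ with t , t< , refl ← ∈-applyUpTo⁻ (λ t → lo ℤ.+ + t) k∈ =
  ℤ.i≤i+j lo (+ t) ,
  subst₂ ℤ._≤_ (lhs lo (+ t)) (rhs lo hi)
    (ℤ.+-monoʳ-≤ (lo ℤ.- 1ℤ) (<-∣⊔0∣⁻ (hi ℤ.- lo ℤ.+ 1ℤ) t<))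
  where
  lhs : ∀ x t → x ℤ.- 1ℤ ℤ.+ (1ℤ ℤ.+ t) ≡ x ℤ.+ t
  lhs = solve-∀
  rhs : ∀ x y → x ℤ.- 1ℤ ℤ.+ (y ℤ.- x ℤ.+ 1ℤ) ≡ y
  rhs = solve-∀

∈-interval⁺ : ∀ {lo hi k} → lo ℤ.≤ k → k ℤ.≤ hi → k ∈ interval lo hi
∈-interval⁺ {lo} {hi} {k} lo≤k k≤hi =
  -- The offset of `k` in the list is `k - lo`, written as an absolute value to obtain a natural
  -- number.
  subst (_∈ interval lo hi) (trans (cong (λ d → lo ℤ.+ d) t≡) (lemma₁ lo k))
    (∈-applyUpTo⁺ (λ t → lo ℤ.+ + t) (<-∣⊔0∣⁺ (hi ℤ.- lo ℤ.+ 1ℤ)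
      (subst₂ ℤ._≤_ (trans (lemma₂ lo k) (cong (λ d → 1ℤ ℤ.+ d) (sym t≡))) (lemma₂′ lo hi)
        (ℤ.+-monoʳ-≤ (1ℤ ℤ.- lo) k≤hi))))
  where
  t≡ : + ℤ.∣ k ℤ.- lo ∣ ≡ k ℤ.- lo
  t≡ = ℤ.0≤i⇒+∣i∣≡i (ℤ.i≤j⇒0≤j-i lo≤k)
  lemma₁ : ∀ x y → x ℤ.+ (y ℤ.- x) ≡ y
  lemma₁ = solve-∀
  lemma₂ : ∀ x y → 1ℤ ℤ.- x ℤ.+ y ≡ 1ℤ ℤ.+ (y ℤ.- x)
  lemma₂ = solve-∀
  lemma₂′ : ∀ x y → 1ℤ ℤ.- x ℤ.+ y ≡ y ℤ.- x ℤ.+ 1ℤ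
  lemma₂′ = solve-∀

-- Induction on `r` with `hi` arbitrary, because the limit on the next coordinate depends on the
-- value `k` of the leading one. Different `k` give tuples with different heads.
tuples-counted : ∀ m α r hi → Counted (WithinLimits m α {r} hi) (nestedSum m α r hi)
tuples-counted m α zero hi =
  counted-resp (λ { refl → tt }) (λ { {[]} _ → refl }) (counted-singleton [])
tuples-counted m α (suc i) hi = counted-resp
  (λ { (k , k∈ , ks , lim , refl) → let (l , u) = ∈-interval⁻ k∈ in l , u , lim })
  (λ { {k ∷ ks} (l , u , lim) → k , ∈-interval⁺ l u , ks , lim , refl })
  (counted-∃ (interval-unique _ hi)
    (λ { _ _ (_ , _ , refl) (_ , _ , eq) → proj₁ (∷-injective eq) })
    (λ {k} _ → counted-image (proj₂ ∘ ∷-injective) (tuples-counted m α i (upper m α i k))))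

-- Gapless partitions as staircases.

-- A staircase of height `i` uses exactly the parts 1, m, ..., m^(i-1), in decreasing order. The
-- multiplicity `suc a` forces each of them to occur, so a gapless partition with largest part m^r
-- has height `suc r`.
data Staircase (m : ℕ) : ℕ → List ℕ → Set where
  []   : Staircase m 0 []
  step : ∀ {i xs} a → Staircase m i xs →
         Staircase m (suc i) (replicate (suc a) (m ^ i) ++ xs)

∈-replicate⁻ : ∀ {A : Set} {x y : A} n → x ∈ replicate n y → x ≡ y
∈-replicate⁻ (suc n) (here eq)  = eq
∈-replicate⁻ (suc n) (there x∈) = ∈-replicate⁻ n x∈

sum-replicate-++ : ∀ a p xs → sum (replicate a p ++ xs) ≡ a * p + sum xs
sum-replicate-++ zero    p xs = refl
sum-replicate-++ (suc a) p xs =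
  trans (cong (λ s → p + s) (sum-replicate-++ a p xs)) (sym (+-assoc p (a * p) (sum xs)))

∈⇒≤sum : ∀ {x xs} → x ∈ xs → x ≤ sum xs
∈⇒≤sum {xs = _ ∷ xs} (here refl) = m≤m+n _ (sum xs)
∈⇒≤sum {xs = y ∷ _}  (there x∈)  = ≤-trans (∈⇒≤sum x∈) (m≤n+m _ y)

replicate-++-injective : ∀ {p xs ys} a b → All (_< p) xs → All (_< p) ys →
  replicate a p ++ xs ≡ replicate b p ++ ys → a ≡ b × xs ≡ ys
replicate-++-injective zero    zero    _ _ eq = refl , eq
replicate-++-injective zero    (suc b) (p<p ∷ _) _ refl = contradiction refl (<⇒≢ p<p)
replicate-++-injective (suc a) zero    _ (p<p ∷ _) refl = contradiction refl (<⇒≢ p<p)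
replicate-++-injective (suc a) (suc b) xs< ys< eq
  with a≡b , xs≡ys ← replicate-++-injective a b xs< ys< (∷-injectiveʳ eq) =
  cong suc a≡b , xs≡ys

replicate-++-sorted : ∀ {p xs} a → All (_≤ p) xs → AllPairs _≥_ xs →
  AllPairs _≥_ (replicate a p ++ xs)
replicate-++-sorted zero    xs≤ sorted = sorted
replicate-++-sorted (suc a) xs≤ sorted =
  All.++⁺ (All.replicate⁺ a ≤-refl) xs≤ ∷ replicate-++-sorted a xs≤ sorted

-- In a decreasing list bounded by `p` the copies of `p` form an initial block, possibly empty: once
-- an entry is below `p`, so are all later ones.
peel : ∀ p xs → AllPairs _≥_ xs → All (_≤ p) xs →
  ∃[ a ] ∃[ ys ] xs ≡ replicate a p ++ ys × All (_< p) ys × AllPairs _≥_ ys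
peel p []       _               _          = 0 , [] , refl , [] , []
peel p (x ∷ xs) (x≥ ∷ sorted) (x≤p ∷ xs≤p) with x ≟ p
... | yes refl = let (a , ys , eq , rest) = peel p xs sorted xs≤p in
                 suc a , ys , cong (p ∷_) eq , rest
... | no x≢p   = 0 , x ∷ xs , refl , x<p ∷ All.map (λ y≤x → ≤-<-trans y≤x x<p) x≥ , x≥ ∷ sorted
  where x<p = ≤∧≢⇒< x≤p x≢p

module _ {m : ℕ} (1<m : 1 < m) where

  private instance
    m≢0 : NonZero m
    m≢0 = >-nonZero (<-trans z<s 1<m)

  ^-cancelʳ-< : ∀ {i k} → m ^ i < m ^ k → i < k
  ^-cancelʳ-< p = ≰⇒> λ k≤i → <⇒≱ p (^-monoʳ-≤ m k≤i)

  staircase-< : ∀ {i xs} → Staircase m i xs → All (_< m ^ i) xs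
  staircase-< []               = []
  staircase-< (step {i} a S) = All.++⁺ (All.replicate⁺ (suc a) m^i<)
    (All.map (λ x< → <-trans x< m^i<) (staircase-< S))
    where m^i< = ^-monoʳ-< m 1<m (n<1+n i)

  staircase-∋ : ∀ {i k xs} → Staircase m i xs → k < i → m ^ k ∈ xs
  staircase-∋ (step a S) (s≤s k≤i) with m≤n⇒m<n∨m≡n k≤i
  ... | inj₁ k<i  = ∈-++⁺ʳ (replicate (suc a) _) (staircase-∋ S k<i)
  ... | inj₂ refl = here refl

  staircase-powers : ∀ {i xs} → Staircase m i xs → All (IsPowerOf m) xs
  staircase-powers []             = []
  staircase-powers (step {i} a S) =
    All.++⁺ (All.replicate⁺ (suc a) (i , refl)) (staircase-powers S)

  staircase-sorted : ∀ {i xs} → Staircase m i xs → AllPairs _≥_ xs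
  staircase-sorted []         = []
  staircase-sorted (step a S) =
    replicate-++-sorted (suc a) (All.map <⇒≤ (staircase-< S)) (staircase-sorted S)

  -- If `k < i`, then m^k would occur by the first staircase and be smaller than itself by the
  -- second. Hence a list has only one height, which separates the partitions by their largest part.
  staircase-height-≤ : ∀ {i k xs} → Staircase m i xs → Staircase m k xs → i ≤ k
  staircase-height-≤ S T = ≮⇒≥ λ k<i →
    <-irrefl refl (All.lookup (staircase-< T) (staircase-∋ S k<i))

  sorted⇒staircase : ∀ i xs → AllPairs _≥_ xs → All (IsPowerOf m) xs →
    All (_< m ^ i) xs → (∀ k → k < i → m ^ k ∈ xs) → Staircase m i xs
  sorted⇒staircase zero []      _ _ _ _ = []
  sorted⇒staircase zero (x ∷ _) _ ((e , refl) ∷ _) (x<1 ∷ _) _ =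
    contradiction (m^n>0 m e) (<⇒≱ x<1)
  sorted⇒staircase (suc i) xs sorted powers xs< ∋
    with peel (m ^ i) xs sorted (All.zipWith bound (powers , xs<))
    where
    -- A power of m below m^(i+1) has exponent at most `i`.
    bound : ∀ {x} → IsPowerOf m x × x < m ^ suc i → x ≤ m ^ i
    bound ((e , refl) , x<) = ^-monoʳ-≤ m (s≤s⁻¹ (^-cancelʳ-< {e} {suc i} x<))
  -- An empty block is excluded because m^i has to occur.
  ... | zero  , ys , refl , ys< , _ =
    contradiction refl (<⇒≢ (All.lookup ys< (∋ i (n<1+n i))))
  ... | suc a , ys , refl , ys< , ys-sorted = step a
    (sorted⇒staircase i ys ys-sorted (All.++⁻ʳ (replicate (suc a) (m ^ i)) powers) ys< ∋′)
    where
    ∋′ : ∀ k → k < i → m ^ k ∈ ys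
    ∋′ k k<i with ∈-++⁻ (replicate (suc a) (m ^ i)) (∋ k (m<n⇒m<1+n k<i))
    ... | inj₁ k∈ = contradiction (∈-replicate⁻ (suc a) k∈) (<⇒≢ (^-monoʳ-< m 1<m k<i))
    ... | inj₂ k∈ = k∈

  staircase⇒gapless : ∀ {r xs} → Staircase m (suc r) xs → IsGaplessMAryPartition m (sum xs) xs
  staircase⇒gapless {r} {xs} S = record
    { isPartition = record
        { decreasing = AllPairs⇒Linked (staircase-sorted S)
        ; positive   = All.map (λ { (e , refl) → m^n>0 m e }) (staircase-powers S)
        ; total      = refl
        }
    ; mAry        = staircase-powers S
    ; withoutGaps = λ i (m^i∈ , _) k k<i →
        staircase-∋ S (<-trans k<i (^-cancelʳ-< {i} {suc r} (All.lookup (staircase-< S) m^i∈)))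
    }

  -- The list is decreasing, so its first entry is the largest part and its exponent is `r`. The
  -- empty list is excluded by `1 ≤ n`.
  gapless⇒staircase : ∀ {n xs} → 1 ≤ n → IsGaplessMAryPartition m n xs →
    ∃[ r ] Staircase m (suc r) xs
  gapless⇒staircase {xs = []} 1≤n g =
    contradiction (IsPartition.total (IsGaplessMAryPartition.isPartition g)) (<⇒≢ 1≤n)
  gapless⇒staircase {xs = x ∷ xs} 1≤n record
    { isPartition = record { decreasing = dec } ; mAry = powers@((r , refl) ∷ _) ; withoutGaps = wg } =
    r , sorted⇒staircase (suc r) (x ∷ xs) sorted powers
          (All.map (λ y≤ → ≤-<-trans y≤ (^-monoʳ-< m 1<m (n<1+n r))) xs≤) ∋
    where
    sorted = Linked⇒AllPairs (λ p q → ≤-trans q p) dec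
    xs≤ : All (_≤ m ^ r) (x ∷ xs)
    xs≤ with x≥ ∷ _ ← sorted = ≤-refl ∷ x≥
    ∋ : ∀ k → k < suc r → m ^ k ∈ x ∷ xs
    ∋ k k≤r with m≤n⇒m<n∨m≡n (s≤s⁻¹ k≤r)
    ... | inj₁ k<r  = wg r (here refl , xs≤) k k<r
    ... | inj₂ refl = here refl

-- Base m digits and remainders.

module _ (m : ℕ) (α : ℕ → ℕ) where

  -- For a base m representation of n and `i ≤ j`, this is n mod m^i.
  lowDigits : ℕ → ℕ
  lowDigits i = sum (applyUpTo (λ l → α l * m ^ l) i)

  lowDigits-suc : ∀ i → lowDigits (suc i) ≡ lowDigits i + α i * m ^ i
  lowDigits-suc i = begin
    sum (applyUpTo f (suc i))      ≡⟨ cong sum (applyUpTo-∷ʳ f i) ⟨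
    sum (applyUpTo f i ++ f i ∷ []) ≡⟨ sum-++ (applyUpTo f i) (f i ∷ []) ⟩
    lowDigits i + (f i + 0)             ≡⟨ cong (λ x → lowDigits i + x) (+-identityʳ (f i)) ⟩
    lowDigits i + f i                   ∎
    where
    open ≡-Reasoning
    f = λ l → α l * m ^ l

  -- Each digit from position `r` on contributes a multiple of m^r, so these digits vanish modulo
  -- m^r.
  lowDigits-split : ∀ d r → ∃[ q ] lowDigits (d + r) ≡ lowDigits r + q * m ^ r
  lowDigits-split zero    r = 0 , sym (+-identityʳ (lowDigits r))
  lowDigits-split (suc d) r with q , eq ← lowDigits-split d r = q + α (d + r) * m ^ d , (begin
    lowDigits (suc d + r)                               ≡⟨ lowDigits-suc (d + r) ⟩
    lowDigits (d + r) + a * m ^ (d + r)                 ≡⟨ cong₂ (λ x y → x + a * y) eq (^-distribˡ-+-* m d r) ⟩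
    lowDigits r + q * m ^ r + a * (m ^ d * m ^ r)       ≡⟨ +-assoc (lowDigits r) _ _ ⟩
    lowDigits r + (q * m ^ r + a * (m ^ d * m ^ r))     ≡⟨ cong (λ x → lowDigits r + (q * m ^ r + x)) (*-assoc a (m ^ d) (m ^ r)) ⟨
    lowDigits r + (q * m ^ r + a * m ^ d * m ^ r)       ≡⟨ cong (λ x → lowDigits r + x) (*-distribʳ-+ (m ^ r) q (a * m ^ d)) ⟨
    lowDigits r + (q + a * m ^ d) * m ^ r               ∎)
    where
    open ≡-Reasoning
    a = α (d + r)

module _ {m : ℕ} .{{_ : NonZero m}} {n j : ℕ} {α : ℕ → ℕ}
         (1<m : 1 < m) (rep : IsBaseRepresentation m n j α) where

  open IsBaseRepresentation rep

  lowDigits-< : ∀ i → i ≤ suc j → lowDigits m α i < m ^ i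
  lowDigits-< zero    _     = z<s
  lowDigits-< (suc i) i<1+j = begin-strict
    lowDigits m α (suc i)          ≡⟨ lowDigits-suc m α i ⟩
    lowDigits m α i + α i * m ^ i  <⟨ +-mono-<-≤ (lowDigits-< i (m≤n⇒m≤1+n (s≤s⁻¹ i<1+j)))
                                   (*-monoˡ-≤ (m ^ i) (digit i (s≤s⁻¹ i<1+j))) ⟩
    suc (m ∸ 1) * m ^ i       ≡⟨ cong (λ x → x * m ^ i) (m+[n∸m]≡n (<⇒≤ 1<m)) ⟩
    m * m ^ i                 ∎
    where open ≤-Reasoning

  quotient : ∀ r → r ≤ j → n ≡ lowDigits m α r + ((n / (m ^ r)) {{m^n≢0 m r}}) * m ^ r
  quotient r r≤j = begin
    n                                    ≡⟨ m≡m%n+[m/n]*n n (m ^ r) ⟩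
    n % m ^ r + n / m ^ r * m ^ r        ≡⟨ cong (λ x → x + n / m ^ r * m ^ r) remainder ⟩
    lowDigits m α r + n / m ^ r * m ^ r       ∎
    where
    open ≡-Reasoning
    instance _ = m^n≢0 m r
    r≤1+j = m≤n⇒m≤1+n r≤j
    remainder : n % m ^ r ≡ lowDigits m α r
    remainder with q , eq ← lowDigits-split m α (suc j ∸ r) r = begin
      n % m ^ r                         ≡⟨ cong (λ x → x % m ^ r) value ⟩
      lowDigits m α (suc j) % m ^ r          ≡⟨ cong (λ x → lowDigits m α x % m ^ r) (m∸n+n≡m r≤1+j) ⟨
      lowDigits m α (suc j ∸ r + r) % m ^ r  ≡⟨ cong (λ x → x % m ^ r) eq ⟩
      (lowDigits m α r + q * m ^ r) % m ^ r  ≡⟨ [m+kn]%n≡m%n (lowDigits m α r) q (m ^ r) ⟩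
      lowDigits m α r % m ^ r                ≡⟨ m<n⇒m%n≡m (lowDigits-< r r≤1+j) ⟩
      lowDigits m α r                        ∎

-- The lower limit of one index and the sign of the next upper limit.

-- `χ α (suc i)` reduces to `χ-of (α i)`, so a case split on a single digit suffices.
χ-of : ℕ → ℤ
χ-of d = if d ≡ᵇ 0 then 1ℤ else 0ℤ

-- If `d` is 0, then m k is at least 1, which forces k to be at least 1. If `d` is positive, a
-- negative k would make the limit at most d - 1 - m, which is negative because `d < m`.
upper≥0⇒χ≤ : ∀ m d k → d < m → 0ℤ ℤ.≤ + d ℤ.- 1ℤ ℤ.+ + m ℤ.* k → χ-of d ℤ.≤ k
upper≥0⇒χ≤ (suc m) zero    k _   u≥0 =
  ℤ.i<j⇒suc[i]≤j (ℤ.*-cancelˡ-<-nonNeg (+ suc m) (begin-strict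
    + suc m ℤ.* 0ℤ              ≡⟨ ℤ.*-zeroʳ (+ suc m) ⟩
    0ℤ                          <⟨ ℤ.+<+ z<s ⟩
    1ℤ                          ≤⟨ ℤ.+-monoʳ-≤ 1ℤ u≥0 ⟩
    1ℤ ℤ.+ (0ℤ ℤ.- 1ℤ ℤ.+ + suc m ℤ.* k) ≡⟨ lemma (+ suc m ℤ.* k) ⟩
    + suc m ℤ.* k               ∎))
  where
  open ℤ.≤-Reasoning
  lemma : ∀ x → 1ℤ ℤ.+ (0ℤ ℤ.- 1ℤ ℤ.+ x) ≡ x
  lemma = solve-∀
upper≥0⇒χ≤ m (suc d) (+ k) _ _ = ℤ.+≤+ z≤n
upper≥0⇒χ≤ m (suc d) ℤ.-[1+ k ] d<m u≥0 = contradiction (begin-strict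
    + d ℤ.+ + m ℤ.* ℤ.-[1+ k ]  ≤⟨ ℤ.+-monoʳ-≤ (+ d) (ℤ.*-monoˡ-≤-nonNeg (+ m) {ℤ.-[1+ k ]} {ℤ.-1ℤ} (ℤ.-≤- z≤n)) ⟩
    + d ℤ.+ + m ℤ.* ℤ.-1ℤ       ≡⟨ cong (λ x → + d ℤ.+ x) (trans (ℤ.*-comm (+ m) ℤ.-1ℤ) (ℤ.-1*i≡-i (+ m))) ⟩
    + d ℤ.- + m                 <⟨ ℤ.+-monoˡ-< (ℤ.- + m) (ℤ.+<+ (<-trans (n<1+n d) d<m)) ⟩
    + m ℤ.- + m                 ≡⟨ ℤ.+-inverseʳ (+ m) ⟩
    0ℤ                          ∎) (ℤ.≤⇒≯ u≥0)
  where open ℤ.≤-Reasoning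

χ≤⇒upper≥0 : ∀ m d k .{{_ : NonZero m}} → χ-of d ℤ.≤ k → 0ℤ ℤ.≤ + d ℤ.- 1ℤ ℤ.+ + m ℤ.* k
χ≤⇒upper≥0 m       (suc d) (+ k)     _ rewrite sym (ℤ.pos-* m k) = ℤ.+≤+ z≤n
χ≤⇒upper≥0 (suc m) zero    (+ suc k) _ = ℤ.+≤+ z≤n
χ≤⇒upper≥0 m       zero    (+ zero)  (ℤ.+≤+ ())

-- Staircases with prescribed sum and the indices k.

module _ {m : ℕ} .{{_ : NonZero m}} {n j : ℕ} {α : ℕ → ℕ}
         (1<m : 1 < m) (rep : IsBaseRepresentation m n j α) where

  open IsBaseRepresentation rep

  -- Here hi is the upper limit of k_i, so that hi + 1 = k_i + a_i.
  StaircaseWithTop : ℕ → ℤ → List ℕ → Set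
  StaircaseWithTop i hi xs =
    Staircase m (suc i) xs × + sum xs ≡ (hi ℤ.+ 1ℤ) ℤ.* + (m ^ i) ℤ.+ + lowDigits m α i

  -- The part m^i gets multiplicity hi + 1 - k, that is a_i when `k` is k_i. The absolute value is
  -- just hi - k as soon as `k ≤ hi`.
  prepend : ∀ i → ℤ → ℤ → List ℕ → List ℕ
  prepend i hi k xs = replicate (suc ℤ.∣ hi ℤ.- k ∣) (m ^ i) ++ xs

  pos-sum-replicate : ∀ a p xs → + sum (replicate (suc a) p ++ xs) ≡ (1ℤ ℤ.+ + a) ℤ.* + p ℤ.+ + sum xs
  pos-sum-replicate a p xs = begin
    + sum (replicate (suc a) p ++ xs)   ≡⟨ cong +_ (sum-replicate-++ (suc a) p xs) ⟩
    + (suc a * p) ℤ.+ + sum xs          ≡⟨ cong (λ x → x ℤ.+ + sum xs) (ℤ.pos-* (suc a) p) ⟩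
    + suc a ℤ.* + p ℤ.+ + sum xs        ∎
    where open ≡-Reasoning

  pos-lowDigits-suc : ∀ i → + lowDigits m α (suc i) ≡ + lowDigits m α i ℤ.+ + α i ℤ.* + (m ^ i)
  pos-lowDigits-suc i = trans (cong +_ (lowDigits-suc m α i))
    (cong (λ x → + lowDigits m α i ℤ.+ x) (ℤ.pos-* (α i) (m ^ i)))

  -- The terms in `k` cancel: the k copies of m^(i+1) missing at the top reappear as the m k copies
  -- of m^i in `upper m α i k`.
  prepend-top : ∀ {i hi k xs} → k ℤ.≤ hi → StaircaseWithTop i (upper m α i k) xs →
    StaircaseWithTop (suc i) hi (prepend (suc i) hi k xs)
  prepend-top {i} {hi} {k} {xs} k≤hi (S , eq) = step _ S , (begin
    + sum (prepend (suc i) hi k xs)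
      ≡⟨ pos-sum-replicate ℤ.∣ hi ℤ.- k ∣ (m ^ suc i) xs ⟩
    (1ℤ ℤ.+ + ℤ.∣ hi ℤ.- k ∣) ℤ.* + (m ^ suc i) ℤ.+ + sum xs
      ≡⟨ cong₂ (λ x y → (1ℤ ℤ.+ x) ℤ.* + (m ^ suc i) ℤ.+ y) (ℤ.0≤i⇒+∣i∣≡i (ℤ.i≤j⇒0≤j-i k≤hi)) eq ⟩
    (1ℤ ℤ.+ (hi ℤ.- k)) ℤ.* + (m ^ suc i) ℤ.+ ((upper m α i k ℤ.+ 1ℤ) ℤ.* P ℤ.+ T)
      ≡⟨ cong (λ x → (1ℤ ℤ.+ (hi ℤ.- k)) ℤ.* x ℤ.+ ((upper m α i k ℤ.+ 1ℤ) ℤ.* P ℤ.+ T)) (ℤ.pos-* m (m ^ i)) ⟩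
    (1ℤ ℤ.+ (hi ℤ.- k)) ℤ.* (+ m ℤ.* P) ℤ.+ ((upper m α i k ℤ.+ 1ℤ) ℤ.* P ℤ.+ T)
      ≡⟨ regroup hi k (+ m) P (+ α i) T ⟩
    (hi ℤ.+ 1ℤ) ℤ.* (+ m ℤ.* P) ℤ.+ (T ℤ.+ + α i ℤ.* P)
      ≡⟨ cong₂ (λ x y → (hi ℤ.+ 1ℤ) ℤ.* x ℤ.+ y) (ℤ.pos-* m (m ^ i)) (pos-lowDigits-suc i) ⟨
    (hi ℤ.+ 1ℤ) ℤ.* + (m ^ suc i) ℤ.+ + lowDigits m α (suc i) ∎)
    where
    open ≡-Reasoning
    P = + (m ^ i)
    T = + lowDigits m α i
    regroup : ∀ h k M P A T →
      (1ℤ ℤ.+ (h ℤ.- k)) ℤ.* (M ℤ.* P) ℤ.+ ((A ℤ.- 1ℤ ℤ.+ M ℤ.* k ℤ.+ 1ℤ) ℤ.* P ℤ.+ T)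
        ≡ (h ℤ.+ 1ℤ) ℤ.* (M ℤ.* P) ℤ.+ (T ℤ.+ A ℤ.* P)
    regroup = solve-∀

  -- The part m^i occurs, so the sum is at least m^i and exceeds `lowDigits m α i`. The remaining
  -- term (hi + 1) m^i is therefore positive.
  top≥0 : ∀ {i hi xs} → i ≤ suc j → StaircaseWithTop i hi xs → 0ℤ ℤ.≤ hi
  top≥0 {i} {hi} {xs} i≤1+j (S , eq) =
    subst (0ℤ ℤ.≤_) (ℤ.pred-suc hi) (ℤ.i<j⇒i≤pred[j] (subst (0ℤ ℤ.<_) (ℤ.+-comm hi 1ℤ)
      (ℤ.*-cancelʳ-<-nonNeg P (ℤ.≤-<-trans (ℤ.≤-reflexive (ℤ.*-zeroˡ P)) positive))))
    where
    open ℤ.≤-Reasoning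
    P = + (m ^ i)
    T = + lowDigits m α i
    cancel : ∀ x y → x ℤ.+ y ℤ.- y ≡ x
    cancel = solve-∀
    positive : 0ℤ ℤ.< (hi ℤ.+ 1ℤ) ℤ.* P
    positive = begin-strict
      0ℤ                              ≡⟨ ℤ.+-inverseʳ T ⟨
      T ℤ.- T                         <⟨ ℤ.+-monoˡ-< (ℤ.- T) (ℤ.+<+ (lowDigits-< 1<m rep i i≤1+j)) ⟩
      P ℤ.- T                         ≤⟨ ℤ.+-monoˡ-≤ (ℤ.- T) (ℤ.+≤+ (∈⇒≤sum (staircase-∋ 1<m S (n<1+n i)))) ⟩
      + sum xs ℤ.- T                  ≡⟨ cong (λ x → x ℤ.- T) eq ⟩
      (hi ℤ.+ 1ℤ) ℤ.* P ℤ.+ T ℤ.- T   ≡⟨ cancel ((hi ℤ.+ 1ℤ) ℤ.* P) T ⟩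
      (hi ℤ.+ 1ℤ) ℤ.* P               ∎

  -- Inverse to `prepend-top`: the multiplicity `suc a` of the top part equals hi + 1 - k, which
  -- gives k = hi - a.
  remove-top : ∀ {i hi ys} → i ≤ j → StaircaseWithTop (suc i) hi ys →
    ∃[ k ] k ∈ interval (χ α (suc i)) hi ×
      ∃[ xs ] StaircaseWithTop i (upper m α i k) xs × ys ≡ prepend (suc i) hi k xs
  remove-top {i} {hi} i≤j (step {xs = xs} a S , eq) =
    k , ∈-interval⁺ χ≤k (ℤ.i≤j⇒i-k≤j {hi} (+ a) ℤ.≤-refl) , xs , top ,
    cong (λ b → replicate (suc b) (m ^ suc i) ++ xs) (cong ℤ.∣_∣ (sym (lemma hi (+ a))))
    where
    open ≡-Reasoning
    k = hi ℤ.- + a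
    P = + (m ^ i)
    T = + lowDigits m α i
    lemma : ∀ h a → h ℤ.- (h ℤ.- a) ≡ a
    lemma = solve-∀
    cancel : ∀ x y → y ≡ x ℤ.+ y ℤ.- x
    cancel = solve-∀
    regroup : ∀ h a M P A T →
      (h ℤ.+ 1ℤ) ℤ.* (M ℤ.* P) ℤ.+ (T ℤ.+ A ℤ.* P) ℤ.- (1ℤ ℤ.+ a) ℤ.* (M ℤ.* P)
        ≡ (A ℤ.- 1ℤ ℤ.+ M ℤ.* (h ℤ.- a) ℤ.+ 1ℤ) ℤ.* P ℤ.+ T
    regroup = solve-∀
    first = (1ℤ ℤ.+ + a) ℤ.* + (m ^ suc i)
    top : StaircaseWithTop i (upper m α i k) xs
    top = S , (begin
      + sum xs                               ≡⟨ cancel first (+ sum xs) ⟩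
      first ℤ.+ + sum xs ℤ.- first           ≡⟨ cong (λ x → x ℤ.- first) (pos-sum-replicate a (m ^ suc i) xs) ⟨
      + sum (replicate (suc a) (m ^ suc i) ++ xs) ℤ.- first ≡⟨ cong (λ x → x ℤ.- first) eq ⟩
      (hi ℤ.+ 1ℤ) ℤ.* + (m ^ suc i) ℤ.+ + lowDigits m α (suc i) ℤ.- first
        ≡⟨ cong₂ (λ x y → (hi ℤ.+ 1ℤ) ℤ.* x ℤ.+ y ℤ.- (1ℤ ℤ.+ + a) ℤ.* x) (ℤ.pos-* m (m ^ i)) (pos-lowDigits-suc i) ⟩
      (hi ℤ.+ 1ℤ) ℤ.* (+ m ℤ.* P) ℤ.+ (T ℤ.+ + α i ℤ.* P) ℤ.- (1ℤ ℤ.+ + a) ℤ.* (+ m ℤ.* P)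
        ≡⟨ regroup hi (+ a) (+ m) P (+ α i) T ⟩
      (upper m α i k ℤ.+ 1ℤ) ℤ.* P ℤ.+ T     ∎)
    χ≤k : χ α (suc i) ℤ.≤ k
    -- The staircase left after removal still contains m^i, so its limit is nonnegative, and this is
    -- equivalent to the lower limit on `k`.
    χ≤k = upper≥0⇒χ≤ m (α i) k (≤-<-trans (digit i i≤j) (∸-monoʳ-< z<s (<⇒≤ 1<m)))
            (top≥0 (m≤n⇒m≤1+n i≤j) top)

  -- All other entries are below m^i, so the number of copies of m^i, and with it `k`, can be read
  -- off the list.
  prepend-injective : ∀ {i hi k l xs ys} → k ℤ.≤ hi → l ℤ.≤ hi →
    All (_< m ^ i) xs → All (_< m ^ i) ys →
    prepend i hi k xs ≡ prepend i hi l ys → k ≡ l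
  prepend-injective {hi = hi} {k} {l} k≤hi l≤hi xs< ys< eq =
    ℤ.neg-injective (ℤ-Group.∙-cancelˡ hi _ _ (begin
      hi ℤ.- k            ≡⟨ ℤ.0≤i⇒+∣i∣≡i (ℤ.i≤j⇒0≤j-i k≤hi) ⟨
      + ℤ.∣ hi ℤ.- k ∣    ≡⟨ cong +_ (suc-injective (proj₁ (replicate-++-injective _ _ xs< ys< eq))) ⟩
      + ℤ.∣ hi ℤ.- l ∣    ≡⟨ ℤ.0≤i⇒+∣i∣≡i (ℤ.i≤j⇒0≤j-i l≤hi) ⟩
      hi ℤ.- l            ∎))
    where open ≡-Reasoning

  -- Induction on `i`, removing the top part. The condition on `hi` matters at `i = 0`: `nestedSum`
  -- is 1 there for every limit, whereas the single staircase, hi + 1 ones, needs hi to be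
  -- nonnegative.
  staircases-counted : ∀ i hi → i ≤ j → 0ℤ ℤ.≤ hi →
    Counted (StaircaseWithTop i hi) (nestedSum m α i hi)
  staircases-counted zero (+ h) _ _ = counted-resp
    (λ { refl → step h [] , trans (pos-sum-replicate h 1 []) (to-top (+ h)) })
    (λ { (step a [] , eq) → cong (λ b → replicate (suc b) 1 ++ [])
           (suc-injective (ℤ.+-injective (begin
             + suc a                          ≡⟨ simplify (+ a) ⟩
             (1ℤ ℤ.+ + a) ℤ.* 1ℤ ℤ.+ 0ℤ       ≡⟨ pos-sum-replicate a 1 [] ⟨
             + sum (replicate (suc a) 1 ++ []) ≡⟨ eq ⟩
             (+ h ℤ.+ 1ℤ) ℤ.* 1ℤ ℤ.+ 0ℤ       ≡⟨ to-top (+ h) ⟨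
             (1ℤ ℤ.+ + h) ℤ.* 1ℤ ℤ.+ 0ℤ       ≡⟨ simplify (+ h) ⟨
             + suc h                          ∎))) })
    (counted-singleton (replicate (suc h) 1 ++ []))
    where
    open ≡-Reasoning
    to-top : ∀ h → (1ℤ ℤ.+ h) ℤ.* 1ℤ ℤ.+ 0ℤ ≡ (h ℤ.+ 1ℤ) ℤ.* 1ℤ ℤ.+ 0ℤ
    to-top = solve-∀
    simplify : ∀ h → 1ℤ ℤ.+ h ≡ (1ℤ ℤ.+ h) ℤ.* 1ℤ ℤ.+ 0ℤ
    simplify = solve-∀
  staircases-counted (suc i) hi i<j _ = counted-resp
    (λ { (k , k∈ , xs , top , eq) → subst (StaircaseWithTop (suc i) hi) (sym eq)
           (prepend-top {hi = hi} (≤hi k∈) top) })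
    (remove-top {hi = hi} (<⇒≤ i<j))
    (counted-∃ (interval-unique _ hi)
      (λ { k∈ l∈ (_ , (S , _) , eq₁) (_ , (T , _) , eq₂) →
             prepend-injective {suc i} {hi} (≤hi k∈) (≤hi l∈)
               (staircase-< 1<m S) (staircase-< 1<m T) (trans (sym eq₁) eq₂) })
      (λ {k} k∈ → counted-image
        (λ {xs} {ys} → ++-cancelˡ (replicate (suc ℤ.∣ hi ℤ.- k ∣) (m ^ suc i)) xs ys)
        -- The lower limit on `k` supplies the nonnegativity of the next upper limit.
        (staircases-counted i (upper m α i k) (<⇒≤ i<j)
          (χ≤⇒upper≥0 m (α i) k (proj₁ (∈-interval⁻ {χ α (suc i)} {hi} k∈))))))
    where
    ≤hi : ∀ {k} → k ∈ interval (χ α (suc i)) hi → k ℤ.≤ hi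
    ≤hi = proj₂ ∘ ∈-interval⁻ {χ α (suc i)} {hi}

  -- As `topUpper m n r` is the quotient of n by m^r minus 1, this is division with remainder,
  -- written as the sum condition of `StaircaseWithTop`.
  topUpper-sum : ∀ r → r ≤ j → + n ≡ (topUpper m n r ℤ.+ 1ℤ) ℤ.* + (m ^ r) ℤ.+ + lowDigits m α r
  topUpper-sum r r≤j = begin
    + n                                             ≡⟨ cong +_ (quotient 1<m rep r r≤j) ⟩
    + lowDigits m α r ℤ.+ + (q * m ^ r)                  ≡⟨ cong (λ x → + lowDigits m α r ℤ.+ x) (ℤ.pos-* q (m ^ r)) ⟩
    + lowDigits m α r ℤ.+ + q ℤ.* + (m ^ r)              ≡⟨ lemma (+ lowDigits m α r) (+ q) (+ (m ^ r)) ⟩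
    (topUpper m n r ℤ.+ 1ℤ) ℤ.* + (m ^ r) ℤ.+ + lowDigits m α r ∎
    where
    open ≡-Reasoning
    q = (n / (m ^ r)) {{m^n≢0 m r}}
    lemma : ∀ T q P → T ℤ.+ q ℤ.* P ≡ (q ℤ.- 1ℤ ℤ.+ 1ℤ) ℤ.* P ℤ.+ T
    lemma = solve-∀

  -- Summation over the largest part.

  gapless-counted : 1 ≤ n → m ^ j ≤ n → n < m ^ suc j →
    Counted (IsGaplessMAryPartition m n) (sum (applyUpTo (N m n α) (suc j)))
  gapless-counted 1≤n m^j≤n n<m^1+j =
    subst (Counted _) (cong sum (map-upTo (N m n α) (suc j))) (counted-resp
      (λ { (r , r∈ , S , eq) → subst (λ s → IsGaplessMAryPartition m s _)
             (ℤ.+-injective (trans eq (sym (topUpper-sum r (s≤s⁻¹ (∈-upTo⁻ r∈))))))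
             (staircase⇒gapless 1<m S) })
      to-staircase
      (counted-∃ (Unique.upTo⁺ (suc j))
        -- Different `r` give disjoint sets, since the height is determined by the list.
        (λ { _ _ (S , _) (T , _) → suc-injective (≤-antisym
               (staircase-height-≤ 1<m S T) (staircase-height-≤ 1<m T S)) })
        (λ {r} r∈ → staircases-counted r (topUpper m n r) (s≤s⁻¹ (∈-upTo⁻ r∈))
          (top-nonneg r (s≤s⁻¹ (∈-upTo⁻ r∈))))))
    where
    top-nonneg : ∀ r → r ≤ j → 0ℤ ℤ.≤ topUpper m n r
    top-nonneg r r≤j = ℤ.i≤j⇒0≤j-i (ℤ.+≤+
      (m≥n⇒m/n>0 {{m^n≢0 m r}} (≤-trans (^-monoʳ-≤ m r≤j) m^j≤n)))
    to-staircase : ∀ {xs} → IsGaplessMAryPartition m n xs →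
      ∃[ r ] r ∈ upTo (suc j) × StaircaseWithTop r (topUpper m n r) xs
    to-staircase {xs} g with r , S ← gapless⇒staircase 1<m 1≤n g =
      r , ∈-upTo⁺ r<1+j , S , trans (cong +_ sum≡n) (topUpper-sum r (s≤s⁻¹ r<1+j))
      where
      sum≡n = IsPartition.total (IsGaplessMAryPartition.isPartition g)
      -- The part m^r is at most n, hence below m^(j+1).
      r<1+j = ^-cancelʳ-< 1<m {r} {suc j} (≤-<-trans
        (≤-trans (∈⇒≤sum (staircase-∋ 1<m S (n<1+n r))) (≤-reflexive sum≡n)) n<m^1+j)

theorem1p3 : (m n j : ℕ) .{{_ : NonZero m}} (α : ℕ → ℕ) →
    2 ≤ m → 1 ≤ n → m ^ j ≤ n → n < m ^ (suc j) →
    IsBaseRepresentation m n j α →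
    HasCardinality (IsGaplessMAryPartition m n)
    (1 + sum (applyUpTo (λ i → N m n α (suc i)) j))
    × (∀ r → 1 ≤ r → r ≤ j → HasCardinality (IsAdmissible m n α r) (N m n α r))
theorem1p3 m n j α 1<m 1≤n m^j≤n n<m^1+j rep =
    -- The summand for r = 0, `N m n α 0`, reduces to 1 and becomes the leading 1 of the formula.
    counted⇒cardinality (gapless-counted 1<m rep 1≤n m^j≤n n<m^1+j)
  , λ r _ _ → counted⇒cardinality (tuples-counted m α r (topUpper m n r))
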